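{- Let $(\Sigma,\oplus,e,|\cdot|,\mathsf{stable})$ be a separation algebra, let $A$ be an assertion and $B$ a well-formed assertion, let $\sigma,\sigma'\in\Sigma$, let $S_A\subseteq\Sigma$, and let $S'\subseteq\Sigma\times\Sigma$ be a witness set. Suppose that 1. $S_A$ contains all states that satisfy $A$, i.e. for all $\sigma_A\in\Sigma$, $\sigma_A\models A$ implies $\sigma_A\in S_A$; 2. the reduction $$\vdash \langle B,\ \lambda\_.\,\top,\ (\sigma,\{(\sigma_A,e)\mid \sigma_A\in S_A\})\rangle \rightsquigarrow (\sigma',S')$$ is derivable in the package logic; and 3. at least one of the following holds: (a) $B$ is intuitionistic; (b) for all $(\sigma_A,\sigma_B)\in S'$, $\sigma_A$ contains no permission, i.e. $\sigma_A\oplus\sigma_A=\sigma_A$. Then there exists a state $\sigma_w\in\Sigma$ with $\mathsf{stable}(\sigma_w)$ such that $\sigma=\sigma'\oplus\sigma_w$ and $\sigma_w$ is a footprint of $A\mathbin{ -\!\!*}B$.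
   Context: **Separation algebra.** A separation algebra is a quintuple $(\Sigma,\oplus,e,|\cdot|,\mathsf{stable})$ where $\Sigma$ is a set of states; $\oplus$ is a partial binary operation on $\Sigma$ that is commutative and associative (in the sense of partial commutative monoids: one side is defined iff the other is, and then they are equal) with neutral element $e\in\Sigma$; $|\cdot|:\Sigma\to\Sigma$ (the core) is a total function; $\mathsf{stable}$ is a predicate on $\Sigma$; and the following axioms hold (an equation $c=a\oplus b$ includes the assertion that $a\oplus b$ is defined), for all states: (a) $x=x\oplus|x|$ and $|x|=|x|\oplus|x|$; (b) if $x=x\oplus c$ then there is $r\in\Sigma$ with $|x|=c\oplus r$; (c) if $c=a\oplus b$ then $|c|=|a|\oplus|b|$; (d) $\mathsf{stable}(e)$, and if $c=a\oplus b$, $\mathsf{stable}(a)$ and $\mathsf{stable}(b)$, then $\mathsf{stable}(c)$; (e) if $c=a\oplus b$ and $c=c\oplus c$ then $a=a\oplus a$; (f) if $a=b\oplus x$, $a=b\oplus y$ and $|x|=|y|$, then $x=y$. Write $\sigma_1\#\sigma_2$ iff $\sigma_1\oplus\sigma_2$ is defined, and $\sigma_2\succeq\sigma_1$ iff there is $\sigma_r$ with $\sigma_2=\sigma_1\oplus\sigma_r$. If $\sigma_2\succeq\sigma_1$, then $\sigma_2\ominus\sigma_1$ denotes the $\succeq$-largest state $\sigma_r$ with $\sigma_2=\sigma_1\oplus\sigma_r$. A state $\sigma$ is pure iff $\sigma=\sigma\oplus\sigma$. **Assertions.** A semantic assertion is a function $\mathcal B:\Sigma\to\{\top,\bot\}$.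 Assertions are given by the grammar $A ::= A*A\mid \mathcal B\Rightarrow A\mid \mathcal B$, where the left-hand side $\mathcal B$ of an implication is a semantic assertion. Satisfaction: $\sigma\models A_1*A_2$ iff there are $\sigma_1,\sigma_2$ with $\sigma=\sigma_1\oplus\sigma_2$, $\sigma_1\models A_1$, $\sigma_2\models A_2$; $\sigma\models\mathcal B\Rightarrow A$ iff ($\mathcal B(\sigma)$ implies $\sigma\models A$); $\sigma\models\mathcal B$ iff $\mathcal B(\sigma)$. **Well-formedness.** $\mathit{monoPure}(\mathcal B)$ holds iff for all $\sigma,\sigma_p\in\Sigma$ with $\sigma_p$ pure, $\mathcal B(\sigma)$ and $\sigma\#\sigma_p$, we have $\mathcal B(\sigma\oplus\sigma_p)$. Well-formedness $\mathit{wf}$ of assertions: $\mathit{wf}(A_1*A_2)$ iff $\mathit{wf}(A_1)$ and $\mathit{wf}(A_2)$; $\mathit{wf}(\mathcal B\Rightarrow A)$ iff $\mathcal B$ is pure (i.e. $\mathcal B(\sigma)\Leftrightarrow\mathcal B(|\sigma|)$ for all $\sigma$), $\mathit{monoPure}(\lnot\mathcal B)$ and $\mathit{wf}(A)$; $\mathit{wf}(\mathcal B)$ iff $\mathit{monoPure}(\mathcal B)$. **Intuitionistic.** $B$ is intuitionistic iff $\sigma\models B$ and $\sigma'\succeq\sigma$ imply $\sigma'\models B$. **Footprint.** A state $\sigma_w$ is a footprint of $A\mathbin{ -\!\!*}B$ iff for all $\sigma_A\in\Sigma$ with $\sigma_A\models A$ and $\sigma_A\#\sigma_w$, $\sigma_A\oplus\sigma_w\models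 B$. **Package logic.** A witness set is a set of pairs $(\sigma_A,\sigma_B)$ of states. A context $\Delta$ is a pair $(\sigma,S)$ of a state and a witness set. A path condition $pc$ is a function $\Sigma\to\{\top,\bot\}$. A configuration is a triple $\langle B,pc,\Delta\rangle$ with $B$ an assertion. The judgement $\vdash\langle B,pc,\Delta\rangle\rightsquigarrow\Delta'$ is inductively defined by the four rules below ($(\sigma_A\oplus\sigma_B)\#\sigma_w$ means that $\sigma_A\oplus\sigma_B$ is defined and compatible with $\sigma_w$; the states written with $\oplus$ in the new witness sets are understood to be defined, which is always the case when derivations start from witness sets all of whose pairs have compatible components, such as those with second component $e$). - *Implication*: from $\langle A,\lambda\sigma.\,pc(\sigma)\land b(\sigma),\Delta\rangle\rightsquigarrow\Delta'$ infer $\langle b\Rightarrow A,pc,\Delta\rangle\rightsquigarrow\Delta'$. - *Star*: from $\langle A_1,pc,\Delta_0\rangle\rightsquigarrow\Delta_1$ and $\langle A_2,pc,\Delta_1\rangle\rightsquigarrow\Delta_2$ infer $\langle A_1*A_2,pc,\Delta_0\rangle\rightsquigarrow\Delta_2$. - *Atom*: let $\mathit{choice}:\Sigma\times\Sigma\to\Sigma$ be any function such that for all $(\sigma_A,\sigma_B)\in S$ with $pc(\sigma_A)$, $\sigma_A\succeq\mathit{choice}(\sigma_A,\sigma_B)$ and $\mathcal B(\mathit{choice}(\sigma_A,\sigma_B))$. Let $S_\top=\{(\sigma_A\ominus\mathit{choice}(\sigma_A,\sigma_B),\ \sigma_B\oplus\mathit{choice}(\sigma_A,\sigma_B))\mid(\sigma_A,\sigma_B)\in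 S\land pc(\sigma_A)\}$ and $S_\bot=\{(\sigma_A,\sigma_B)\mid(\sigma_A,\sigma_B)\in S\land\lnot pc(\sigma_A)\}$. Infer $\langle\mathcal B,pc,(\sigma,S)\rangle\rightsquigarrow(\sigma,S_\top\cup S_\bot)$. - *Extract*: from $\sigma_0=\sigma_1\oplus\sigma_w$, $\mathsf{stable}(\sigma_w)$, $S_1=\{(\sigma_A\oplus\sigma_w,\sigma_B)\mid(\sigma_A,\sigma_B)\in S_0\land(\sigma_A\oplus\sigma_B)\#\sigma_w\}$ and $\langle A,pc,(\sigma_1,S_1)\rangle\rightsquigarrow\Delta$ infer $\langle A,pc,(\sigma_0,S_0)\rangle\rightsquigarrow\Delta$. -}

module Defs where

open import Data.Bool using (Bool; T; not; _∧_)
open import Data.Maybe using (Maybe; just; _>>=_)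
open import Data.Product using (∃-syntax; _×_; _,_)
open import Function using (_⇔_)
open import Level using (Level; Lift; suc)
open import Relation.Binary.PropositionalEquality using (_≡_)
open import Relation.Nullary using (¬_)
open import Relation.Unary using (Pred; _∈_; _∪_; _≐_)

-- The partial operation is Maybe-valued: `a ⊕ b ≡ just c` says that a ⊕ b is
-- defined and equal to c.  In `⊕-assoc` and `⊕-comm`, equality in Maybe
-- expresses that one side is defined iff the other is, with equal values.
record SeparationAlgebra (ℓ : Level) : Set (suc ℓ) where
  infixl 6 _⊕_
  field
    State  : Set ℓ
    _⊕_    : State → State → Maybe State
    e      : State
    core   : State → State
    Stable : Pred State ℓ

    ⊕-comm      : ∀ a b → a ⊕ b ≡ b ⊕ a
    ⊕-assoc     : ∀ a b c → ((a ⊕ b) >>= λ ab → ab ⊕ c) ≡ ((b ⊕ c) >>= λ bc → a ⊕ bc)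
    ⊕-identityʳ : ∀ a → a ⊕ e ≡ just a

    core-absorb : ∀ x → x ⊕ core x ≡ just x
    core-pure   : ∀ x → core x ⊕ core x ≡ just (core x)
    core-max    : ∀ x c → x ⊕ c ≡ just x → ∃[ r ] (c ⊕ r ≡ just (core x))
    core-⊕      : ∀ a b c → a ⊕ b ≡ just c → core a ⊕ core b ≡ just (core c)
    stable-e    : Stable e
    stable-⊕    : ∀ a b c → a ⊕ b ≡ just c → Stable a → Stable b → Stable c
    pure-≼      : ∀ a b c → a ⊕ b ≡ just c → c ⊕ c ≡ just c → a ⊕ a ≡ just a
    ⊕-cancel    : ∀ a b x y → b ⊕ x ≡ just a → b ⊕ y ≡ just a → core x ≡ core y → x ≡ y

module PackageLogic {ℓ : Level} (𝕊 : SeparationAlgebra ℓ) where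
  open SeparationAlgebra 𝕊

  infix 4 _#_ _≽_ _≡_⊖_ _⊨_

  _#_ : State → State → Set ℓ
  σ₁ # σ₂ = ∃[ σ ] (σ₁ ⊕ σ₂ ≡ just σ)

  _≽_ : State → State → Set ℓ
  σ₂ ≽ σ₁ = ∃[ σᵣ ] (σ₁ ⊕ σᵣ ≡ just σ₂)

  -- σᵣ is the ≽-largest state whose sum with σ₁ is σ₂.  The operation ⊖ is given
  -- by its graph; such a σᵣ exists whenever σ₂ ≽ σ₁, and is then unique.
  _≡_⊖_ : State → State → State → Set ℓ
  σᵣ ≡ σ₂ ⊖ σ₁ = (σ₁ ⊕ σᵣ ≡ just σ₂) × (∀ τ → σ₁ ⊕ τ ≡ just σ₂ → σᵣ ≽ τ)

  PureState : Pred State ℓ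
  PureState σ = σ ⊕ σ ≡ just σ

  SemAssertion : Set ℓ
  SemAssertion = State → Bool

  infixr 7 _∗_
  infixr 6 _⇒_
  data Assertion : Set ℓ where
    _∗_  : Assertion → Assertion → Assertion
    _⇒_  : SemAssertion → Assertion → Assertion
    atom : SemAssertion → Assertion

  _⊨_ : State → Assertion → Set ℓ
  σ ⊨ A₁ ∗ A₂ = ∃[ σ₁ ] ∃[ σ₂ ] (σ₁ ⊕ σ₂ ≡ just σ × σ₁ ⊨ A₁ × σ₂ ⊨ A₂)
  σ ⊨ b ⇒ A   = T (b σ) → σ ⊨ A
  σ ⊨ atom b  = Lift ℓ (T (b σ))

  MonoPure : SemAssertion → Set ℓ
  MonoPure b = ∀ σ σₚ σ′ → PureState σₚ → T (b σ) → σ ⊕ σₚ ≡ just σ′ → T (b σ′)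

  PureAssertion : SemAssertion → Set ℓ
  PureAssertion b = ∀ σ → T (b σ) ⇔ T (b (core σ))

  WellFormed : Assertion → Set ℓ
  WellFormed (A₁ ∗ A₂) = WellFormed A₁ × WellFormed A₂
  WellFormed (b ⇒ A)   = PureAssertion b × MonoPure (λ σ → not (b σ)) × WellFormed A
  WellFormed (atom b)  = MonoPure b

  Intuitionistic : Assertion → Set ℓ
  Intuitionistic B = ∀ σ σ′ → σ ⊨ B → σ′ ≽ σ → σ′ ⊨ B

  Footprint : Assertion → Assertion → Pred State ℓ
  Footprint A B σw = ∀ σA σ → σA ⊨ A → σA ⊕ σw ≡ just σ → σ ⊨ B

  WitnessSet : Set (suc ℓ)
  WitnessSet = Pred (State × State) ℓ

  Context : Set (suc ℓ)
  Context = State × WitnessSet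

  PathCondition : Set ℓ
  PathCondition = State → Bool

  ValidChoice : SemAssertion → PathCondition → WitnessSet → (State × State → State) → Set ℓ
  ValidChoice b pc S choice = ∀ σA σB → (σA , σB) ∈ S → T (pc σA) →
    σA ≽ choice (σA , σB) × T (b (choice (σA , σB)))

  S⊤ : PathCondition → (State × State → State) → WitnessSet → WitnessSet
  S⊤ pc choice S (σA′ , σB′) = ∃[ σA ] ∃[ σB ]
    ( (σA , σB) ∈ S
    × T (pc σA)
    × (σA′ ≡ σA ⊖ choice (σA , σB))
    × σB ⊕ choice (σA , σB) ≡ just σB′ )

  S⊥ : PathCondition → WitnessSet → WitnessSet
  S⊥ pc S (σA , σB) = (σA , σB) ∈ S × ¬ T (pc σA)

  Extend : State → WitnessSet → WitnessSet
  Extend σw S (σA′ , σB) = ∃[ σA ]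
    ( (σA , σB) ∈ S
    × (∃[ τ ] (σA ⊕ σB ≡ just τ × τ # σw))
    × σA ⊕ σw ≡ just σA′ )

  -- Witness sets are compared extensionally (_≐_), since predicates with the same
  -- elements need not be propositionally equal.
  data ⊢⟨_,_,_⟩⇝_ : Assertion → PathCondition → Context → Context → Set (suc ℓ) where

    implication : ∀ {b A pc Δ Δ′} →
      ⊢⟨ A , (λ σ → pc σ ∧ b σ) , Δ ⟩⇝ Δ′ →
      ⊢⟨ b ⇒ A , pc , Δ ⟩⇝ Δ′

    star : ∀ {A₁ A₂ pc Δ₀ Δ₁ Δ₂} →
      ⊢⟨ A₁ , pc , Δ₀ ⟩⇝ Δ₁ →
      ⊢⟨ A₂ , pc , Δ₁ ⟩⇝ Δ₂ →
      ⊢⟨ A₁ ∗ A₂ , pc , Δ₀ ⟩⇝ Δ₂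

    atom : ∀ {b pc σ S S′} (choice : State × State → State) →
      ValidChoice b pc S choice →
      S′ ≐ (S⊤ pc choice S ∪ S⊥ pc S) →
      ⊢⟨ atom b , pc , (σ , S) ⟩⇝ (σ , S′)

    extract : ∀ {A pc σ₀ σ₁ σw S₀ S₁ Δ} →
      σ₁ ⊕ σw ≡ just σ₀ →
      Stable σw →
      S₁ ≐ Extend σw S₀ →
      ⊢⟨ A , pc , (σ₁ , S₁) ⟩⇝ Δ →
      ⊢⟨ A , pc , (σ₀ , S₀) ⟩⇝ Δ

-- The footprint is the sum σw of all extracted states.  Extraction may change
-- the truth of a path condition: a condition that holds for a witness can fail
-- once σw is added.  A derivation therefore does not make the portion ρ handed
-- over to B satisfy B; what is preserved is that ρ ⊕ |τ′| satisfies B, where τ′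
-- is the whole final state.  The core of ρ ⊕ |τ′| is |τ′|, so the conditions of B
-- take on it the value they take on τ′, and a false condition stays false when
-- more pure resource arrives.  What remains of the witness either is absorbed
-- since B is intuitionistic or is pure and then equal to |τ′|.
module Submission where

open import Data.Bool using (Bool; true; false; T; not; _∧_; T?)
open import Data.Bool.Properties using (T-∧)
open import Data.Maybe using (Maybe; just; _>>=_)
open import Data.Maybe.Properties using (just-injective)
open import Data.Product using (∃-syntax; _×_; _,_; proj₁; proj₂)
open import Data.Sum as Sum using (_⊎_; inj₁; inj₂)
open import Data.Unit using (tt)
open import Function using (mk⇔; Equivalence)
open import Level using (Level; lift; lower)
open import Relation.Binary.PropositionalEquality
  using (_≡_; refl; sym; trans; cong; subst)
open import Relation.Nullary using (contradiction; yes; no)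
open import Relation.Unary using (Pred; _∈_)
open import Defs

>>=-just : ∀ {a} {A B : Set a} (m : Maybe A) {f : A → Maybe B} {y} →
  (m >>= f) ≡ just y → ∃[ x ] (m ≡ just x × f x ≡ just y)
>>=-just (just x) eq = x , refl , eq

T-not-antitone : ∀ {x y} → (T (not x) → T (not y)) → T y → T x
T-not-antitone {true}          _ _  = tt
T-not-antitone {false} {true}  f _  = f tt

T-not-contra : ∀ {x y} → (T y → T x) → T (not x) → T (not y)
T-not-contra {false} {false} _ _ = tt
T-not-contra {false} {true}  f _ = f tt

module SeparationAlgebraProperties {ℓ : Level} (𝕊 : SeparationAlgebra ℓ) where
  open SeparationAlgebra 𝕊
  open PackageLogic 𝕊

  private variable
    a b c p q r u x y z ab bc abc : State

  ⊕-functional : a ⊕ b ≡ just x → a ⊕ b ≡ just y → x ≡ y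
  ⊕-functional eq eq′ = just-injective (trans (sym eq) eq′)

  ⊕-swap : a ⊕ b ≡ just c → b ⊕ a ≡ just c
  ⊕-swap {a} {b} eq = trans (⊕-comm b a) eq

  assocʳ : a ⊕ b ≡ just ab → ab ⊕ c ≡ just abc →
    ∃[ bc ] (b ⊕ c ≡ just bc × a ⊕ bc ≡ just abc)
  assocʳ {a} {b} {ab} {c} eq eq′ = >>=-just (b ⊕ c)
    (trans (sym (⊕-assoc a b c)) (trans (cong (_>>= λ ab → ab ⊕ c) eq) eq′))

  assocˡ : b ⊕ c ≡ just bc → a ⊕ bc ≡ just abc →
    ∃[ ab ] (a ⊕ b ≡ just ab × ab ⊕ c ≡ just abc)
  assocˡ {b} {c} {bc} {a} eq eq′ = >>=-just (a ⊕ b)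
    (trans (⊕-assoc a b c) (trans (cong (_>>= λ bc → a ⊕ bc) eq) eq′))

  pure-absorb : PureState p → p ⊕ q ≡ just r → p ⊕ r ≡ just r
  pure-absorb {p} pp eq with assocʳ pp eq
  ... | _ , eq₁ , eq₂ = subst (λ s → p ⊕ s ≡ just _) (⊕-functional eq₁ eq) eq₂

  -- The sum of `p` and `core p` is `p` by `core-absorb`. It is also `core p`, because `core-max`
  -- places `p` inside `core p` and a pure part is absorbed.
  pure⇒core : PureState p → p ≡ core p
  pure⇒core {p} pp =
    ⊕-functional (⊕-swap (core-absorb p))
                 (⊕-swap (pure-absorb pp (proj₂ (core-max p p pp))))

  core-idem : ∀ x → core (core x) ≡ core x
  core-idem x = sym (pure⇒core (core-pure x))

  core-absorbˡ : x ⊕ y ≡ just z → core x ⊕ core z ≡ just (core z)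
  core-absorbˡ {x} eq = pure-absorb (core-pure x) (core-⊕ _ _ _ eq)

  -- `core u` is the sum of `core x` and `core z`, and `core z` absorbs its pure part `core x`.
  core-saturate : x ⊕ y ≡ just z → x ⊕ core z ≡ just u → core u ≡ core z
  core-saturate {x} {z = z} {u} eq eq′ = ⊕-functional
    (subst (λ s → core x ⊕ s ≡ just (core u)) (core-idem z) (core-⊕ _ _ _ eq′))
    (core-absorbˡ eq)

  saturate : x ⊕ y ≡ just z → ∃[ u ] (x ⊕ core z ≡ just u × y ⊕ u ≡ just z)
  saturate {z = z} eq = assocʳ (⊕-swap eq) (core-absorb z)

  -- The largest remainder is r ⊕ |c|: all remainders saturated in this way have
  -- core |c|, so they coincide by cancellation.
  ⊖-exists : c ≽ a → ∃[ d ] (d ≡ c ⊖ a × core d ≡ core c)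
  ⊖-exists {c} {a} (r , eq) with saturate (⊕-swap eq)
  ... | d , r⊕c , a⊕d = d , (a⊕d , largest) , core-saturate (⊕-swap eq) r⊕c
    where
    largest : ∀ t → a ⊕ t ≡ just c → d ≽ t
    largest t eqₜ with saturate (⊕-swap eqₜ)
    ... | v , t⊕c , a⊕v = core c , trans t⊕c (cong just
      (⊕-cancel c a v d a⊕v a⊕d
        (trans (core-saturate (⊕-swap eqₜ) t⊕c)
               (sym (core-saturate (⊕-swap eq) r⊕c)))))

  -- `u` contains the pure `p` and so absorbs a second copy of it, which leaves one copy for each
  -- summand.
  pure-distrib : PureState p → x ⊕ y ≡ just z → z ⊕ p ≡ just u →
    ∃[ xp ] ∃[ yp ] (x ⊕ p ≡ just xp × y ⊕ p ≡ just yp × xp ⊕ yp ≡ just u)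
  pure-distrib pp x⊕y z⊕p with assocʳ x⊕y z⊕p
  ... | yp , y⊕p , x⊕yp with assocʳ (⊕-swap x⊕yp)
                                    (⊕-swap (pure-absorb pp (⊕-swap z⊕p)))
  ... | xp , x⊕p , yp⊕xp = xp , yp , x⊕p , y⊕p , ⊕-swap yp⊕xp

  ⊨-monoPure : ∀ A → WellFormed A → PureState p → x ⊨ A → x ⊕ p ≡ just y → y ⊨ A
  ⊨-monoPure (A₁ ∗ A₂) (wf₁ , wf₂) pp (_ , _ , eq , s₁ , s₂) x⊕p
    with pure-distrib pp eq x⊕p
  ... | xp , yp , eq₁ , eq₂ , eq₃ =
    xp , yp , eq₃ , ⊨-monoPure A₁ wf₁ pp s₁ eq₁ , ⊨-monoPure A₂ wf₂ pp s₂ eq₂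
  ⊨-monoPure (b ⇒ A) (_ , mono , wf) pp s x⊕p by =
    -- A false `b` stays false when `p` is added, so `b`, true at `y`, was true at `x`.
    ⊨-monoPure A wf pp
      (s (T-not-antitone (λ ¬bx → mono _ _ _ pp ¬bx x⊕p) by)) x⊕p
  ⊨-monoPure (atom b) mono pp s x⊕p = lift (mono _ _ _ pp (lower s) x⊕p)

  Guard : PathCondition → Set ℓ
  Guard pc = PureAssertion pc × MonoPure (λ σ → not (pc σ))

  guard-true : Guard (λ _ → true)
  guard-true = (λ _ → mk⇔ (λ t → t) (λ t → t)) , λ _ _ _ _ ()

  guard-core : ∀ {pc} → Guard pc → core x ≡ core y → T (pc x) → T (pc y)
  guard-core {x} {y} {pc} (pure , _) eq t = Equivalence.from (pure y)
    (subst (λ s → T (pc s)) eq (Equivalence.to (pure x) t))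

  -- Purity moves the question to the cores: `core z` arises from `core x` by adding the pure
  -- `core y`, so falsity at `core x` would persist.
  guard-antitone : ∀ {pc} → Guard pc → x ⊕ y ≡ just z → T (pc z) → T (pc x)
  guard-antitone {x} {y} {z} (pure , mono) eq t = Equivalence.from (pure x)
    (T-not-antitone (λ n → mono _ _ _ (core-pure y) n (core-⊕ _ _ _ eq))
                    (Equivalence.to (pure z) t))

  guard-∧ : ∀ {pc b} → Guard pc → Guard b → Guard (λ σ → pc σ ∧ b σ)
  guard-∧ {pc} {b} g h =
    (λ σ → mk⇔ (both (sym (core-idem σ))) (both (core-idem σ))) ,
    λ _ _ _ _ n eq → T-not-contra (down eq) n
    where
    both : core x ≡ core y → T (pc x ∧ b x) → T (pc y ∧ b y)
    both eq t with Equivalence.to T-∧ t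
    ... | s , s′ = Equivalence.from T-∧ (guard-core g eq s , guard-core h eq s′)
    down : x ⊕ y ≡ just z → T (pc z ∧ b z) → T (pc x ∧ b x)
    down eq t with Equivalence.to T-∧ t
    ... | s , s′ = Equivalence.from T-∧ (guard-antitone g eq s , guard-antitone h eq s′)

  -- The core equation gives a pure path condition the same value on the first component as on the
  -- total `τ`.
  Balanced : State → State → State → Set ℓ
  Balanced σA σB τ = σA ⊕ σB ≡ just τ × core σA ≡ core τ

  -- `ρ` is the portion moved into the second component while `A` is processed. The path condition
  -- is assumed at the final total `τ′`, since its truth at the tested witness may be lost later.
  record Reached (A : Assertion) (pc : PathCondition) (S′ : WitnessSet)
                 (σB τ′ : State) : Set ℓ where
    constructor reached
    field
      {σA′ σB′ ρ} : State
      member      : (σA′ , σB′) ∈ S′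
      balanced    : Balanced σA′ σB′ τ′
      split       : σB ⊕ ρ ≡ just σB′
      satisfied   : ∀ {u} → ρ ⊕ core τ′ ≡ just u → T (pc τ′) → u ⊨ A

  Transports : Assertion → PathCondition → WitnessSet → WitnessSet → State → Set ℓ
  Transports A pc S S′ σw = ∀ {σA σB τ τ′} → (σA , σB) ∈ S → Balanced σA σB τ →
    τ ⊕ σw ≡ just τ′ → Reached A pc S′ σB τ′

  Balanced-extend : ∀ {σA σB τ σw τ′} → Balanced σA σB τ → τ ⊕ σw ≡ just τ′ →
    ∃[ σA′ ] (σA ⊕ σw ≡ just σA′ × Balanced σA′ σB τ′)
  Balanced-extend {σw = σw} (eq , core≡) τ⊕w with assocʳ (⊕-swap eq) τ⊕w
  ... | σA′ , σA⊕w , eq′ = σA′ , σA⊕w , ⊕-swap eq′ , ⊕-functional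
    (core-⊕ _ _ _ σA⊕w)
    (trans (cong (_⊕ core σw) core≡) (core-⊕ _ _ _ τ⊕w))

  Transports-⇒ : ∀ {b A pc S S′ σw} → PureAssertion b → MonoPure (λ σ → not (b σ)) →
    Transports A (λ σ → pc σ ∧ b σ) S S′ σw → Transports (b ⇒ A) pc S S′ σw
  Transports-⇒ {b} pure mono tr m bal τ⊕w with tr m bal τ⊕w
  ... | reached m′ bal′ split sat = reached m′ bal′ split λ eq t bu →
    -- `ρ` is part of `τ′`, so `u` has the core of `τ′` and the truth of `b` passes from `u` to
    -- `τ′`.
    sat eq (Equivalence.from T-∧ (t , guard-core (pure , mono)
      (core-saturate (⊕-swap (proj₂ (proj₂ (assocˡ split (proj₁ bal′))))) eq) bu))

  Transports-∗ : ∀ {A₁ A₂ pc S₀ S₁ S₂ σw₁ σw₂ σw} → WellFormed A₁ → Guard pc →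
    σw₁ ⊕ σw₂ ≡ just σw →
    Transports A₁ pc S₀ S₁ σw₁ → Transports A₂ pc S₁ S₂ σw₂ →
    Transports (A₁ ∗ A₂) pc S₀ S₂ σw
  Transports-∗ {A₁} {A₂} {pc} wf₁ g w₁⊕w₂ tr₁ tr₂ {τ′ = τ′} m bal τ⊕w
    with assocˡ w₁⊕w₂ τ⊕w
  ... | τ₁ , τ⊕w₁ , τ₁⊕w₂ with tr₁ m bal τ⊕w₁
  ... | reached {ρ = ρ₁} m₁ bal₁ split₁ sat₁ with tr₂ m₁ bal₁ τ₁⊕w₂
  ... | reached {ρ = ρ₂} m₂ bal₂ split₂ sat₂ with assocʳ split₁ split₂
  ... | ρ , ρ₁⊕ρ₂ , split = reached m₂ bal₂ split sat
    where
    sat : ρ ⊕ core τ′ ≡ just u → T (pc τ′) → u ⊨ A₁ ∗ A₂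
    sat eq t with pure-distrib (core-pure τ′) ρ₁⊕ρ₂ eq
    -- `A₁` was settled at `τ₁`. As `core τ₁` is absorbed by `core τ′`, `u₁` is the state known to
    -- satisfy `A₁` plus a pure state.
    ... | u₁ , u₂ , eq₁ , eq₂ , eq₃ with assocˡ (core-absorbˡ τ₁⊕w₂) eq₁
    ... | v , ρ₁⊕τ₁ , v⊕τ′ = u₁ , u₂ , eq₃ ,
      ⊨-monoPure A₁ wf₁ (core-pure τ′)
        (sat₁ ρ₁⊕τ₁ (guard-antitone g τ₁⊕w₂ t)) v⊕τ′ ,
      sat₂ eq₂ t

  Transports-atom : ∀ {b pc S S′ choice} → MonoPure b → Guard pc →
    ValidChoice b pc S choice →
    (∀ {s} → S⊤ pc choice S s ⊎ S⊥ pc S s → S′ s) →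
    Transports (atom b) pc S S′ e
  Transports-atom {pc = pc} mono g valid S′⊇ {σA} {σB} {τ} m (eq , core≡) τ⊕e
    with ⊕-functional τ⊕e (⊕-identityʳ τ)
  ... | refl with T? (pc σA)
  -- A skipped witness hands over `e`; the path condition fails at `τ` too, so nothing has to be
  -- satisfied.
  ... | no ¬t = reached (S′⊇ (inj₂ (m , ¬t))) (eq , core≡) (⊕-identityʳ σB)
                  λ _ t → contradiction (guard-core g (sym core≡) t) ¬t
  ... | yes t with valid σA σB m t
  -- The largest remainder keeps the core of `σA`, so the new pair is balanced again.
  ... | σA≽c , bc with ⊖-exists σA≽c
  ... | d , d⊖ , core-d with assocʳ (⊕-swap (proj₁ d⊖)) eq
  ... | σB′ , c⊕σB , d⊕σB′ = reached
    (S′⊇ (inj₁ (σA , σB , m , t , d⊖ , ⊕-swap c⊕σB)))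
    (d⊕σB′ , trans core-d core≡)
    (⊕-swap c⊕σB)
    λ c⊕τ _ → lift (mono _ _ _ (core-pure τ) bc c⊕τ)

  -- Extraction drops only pairs incompatible with `σw₁`; this one survives, because `τ ⊕ σw` is
  -- defined and `σw₁` is part of `σw`.
  Transports-extract : ∀ {A pc S₀ S₁ S₂ σw₁ σw₂ σw} → σw₁ ⊕ σw₂ ≡ just σw →
    (∀ {s} → Extend σw₁ S₀ s → S₁ s) →
    Transports A pc S₁ S₂ σw₂ → Transports A pc S₀ S₂ σw
  Transports-extract w₁⊕w₂ S₁⊇ tr m bal τ⊕w with assocˡ w₁⊕w₂ τ⊕w
  ... | τ₁ , τ⊕w₁ , τ₁⊕w₂ with Balanced-extend bal τ⊕w₁
  ... | _ , σA⊕w₁ , bal₁ =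
    tr (S₁⊇ (_ , m , (_ , proj₁ bal , _ , τ⊕w₁) , σA⊕w₁)) bal₁ τ₁⊕w₂

  derivation-sound : ∀ {A pc Δ Δ′} → WellFormed A → Guard pc →
    ⊢⟨ A , pc , Δ ⟩⇝ Δ′ →
    ∃[ σw ] (Stable σw × proj₁ Δ′ ⊕ σw ≡ just (proj₁ Δ)
                       × Transports A pc (proj₂ Δ) (proj₂ Δ′) σw)
  derivation-sound {b ⇒ A} {pc} (pure , mono , wf) g (implication d)
    with derivation-sound wf (guard-∧ {pc} {b} g (pure , mono)) d
  ... | σw , st , eq , tr = σw , st , eq , Transports-⇒ {pc = pc} pure mono tr
  derivation-sound (wf₁ , wf₂) g (star d₁ d₂)
    with derivation-sound wf₁ g d₁ | derivation-sound wf₂ g d₂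
  ... | _ , st₁ , eq₁ , tr₁ | _ , st₂ , eq₂ , tr₂ with assocʳ eq₂ eq₁
  ... | σw , w₂⊕w₁ , eq = σw , stable-⊕ _ _ _ w₂⊕w₁ st₂ st₁ , eq ,
    Transports-∗ wf₁ g (⊕-swap w₂⊕w₁) tr₁ tr₂
  derivation-sound mono g (atom {σ = σ} choice valid (_ , S′⊇)) =
    e , stable-e , ⊕-identityʳ σ , Transports-atom mono g valid S′⊇
  derivation-sound wf g (extract eq₁ st₁ (_ , S₁⊇) d) with derivation-sound wf g d
  ... | _ , st₂ , eq₂ , tr with assocʳ eq₂ eq₁
  ... | σw , w₂⊕w₁ , eq = σw , stable-⊕ _ _ _ w₂⊕w₁ st₂ st₁ , eq ,
    Transports-extract (⊕-swap w₂⊕w₁) S₁⊇ tr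

  absorb-rest : ∀ {B ρ τ} → Intuitionistic B ⊎ PureState x → Balanced x ρ τ →
    (∀ {u} → ρ ⊕ core τ ≡ just u → u ⊨ B) → τ ⊨ B
  absorb-rest {x} {τ = τ} (inj₁ intu) (eq , _) sat with saturate (⊕-swap eq)
  ... | u , ρ⊕τ , x⊕u = intu u τ (sat ρ⊕τ) (x , ⊕-swap x⊕u)
  absorb-rest {ρ = ρ} {τ} (inj₂ pure) (eq , core≡) sat =
    sat (subst (λ s → ρ ⊕ s ≡ just τ) (trans (pure⇒core pure) core≡) (⊕-swap eq))

theorem1 : {ℓ : Level} (𝕊 : SeparationAlgebra ℓ) →
    let open SeparationAlgebra 𝕊
        open PackageLogic 𝕊
    in
    (A B : Assertion) → WellFormed B →
    (σ σ′ : State) (SA : Pred State ℓ) (S′ : WitnessSet) →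
    (∀ σA → σA ⊨ A → σA ∈ SA) →
    ⊢⟨ B , (λ _ → true) , (σ , λ (σA , σB) → σA ∈ SA × σB ≡ e) ⟩⇝ (σ′ , S′) →
    Intuitionistic B ⊎ (∀ σA σB → (σA , σB) ∈ S′ → PureState σA) →
    ∃[ σw ] (Stable σw × σ′ ⊕ σw ≡ just σ × Footprint A B σw)
theorem1 𝕊 A B wf σ σ′ SA S′ A⊆SA d final
  with SeparationAlgebraProperties.derivation-sound 𝕊 wf
         (SeparationAlgebraProperties.guard-true 𝕊) d
... | σw , st , eq , tr = σw , st , eq , footprint
  where
  open SeparationAlgebra 𝕊
  open PackageLogic 𝕊
  open SeparationAlgebraProperties 𝕊

  footprint : Footprint A B σw
  footprint σA τ sA σA⊕w with tr (A⊆SA σA sA , refl) (⊕-identityʳ σA , refl) σA⊕w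
  ... | reached m bal split sat
    -- The second component starts as `e`, so `ρ` is the whole of the final one.
    with ⊕-functional (⊕-swap split) (⊕-identityʳ _)
  ... | refl = absorb-rest (Sum.map₂ (λ pure → pure _ _ m) final) bal
                 λ eq → sat eq tt
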